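{- Let $\mathbf{w}$ be an infinite overlap-free word over the alphabet $\{0,1\}$. Then there is a position $i$ such that no square (nonempty word of the form $xx$) occurs in $\mathbf{w}$ beginning at position $i$.
   Context: A finite word $w$ is an $\alpha$-power ($\alpha$ rational) if $w = x^n x'$ with $x'$ a prefix of $x$, $x$ nonempty, and $\alpha = n + |x'|/|x|$. A square is a $2$-power, i.e. a word $xx$ with $x$ nonempty. An overlap is a word that is a $\beta$-power for some $\beta > 2$. A (finite or infinite) word is overlap-free if none of its factors (contiguous subwords) is an overlap. -}

module Defs where

open import Data.Integer.Base using (+_)
open import Data.List.Base using (List; _++_; applyUpTo; concat; length; replicate)
open import Data.List.NonEmpty as List⁺ using (List⁺; toList)
open import Data.List.Relation.Binary.Prefix.Heterogeneous using (Prefix)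
open import Data.Nat.Base as ℕ using (ℕ)
open import Data.Product.Base using (∃-syntax; _×_)
open import Data.Rational.Base using (ℚ; _/_; _+_; _>_)
open import Relation.Binary.PropositionalEquality.Core using (_≡_)
open import Relation.Nullary.Negation.Core using (¬_)

private
  variable
    A : Set

InfiniteWord : Set → Set
InfiniteWord A = ℕ → A

IsPower : ℚ → List A → Set
IsPower {A} α w =
  ∃[ n ] ∃[ x ] ∃[ x′ ]
    Prefix {A = A} _≡_ x′ (toList x)
    × w ≡ concat (replicate n (toList x)) ++ x′
    × α ≡ + n / 1 + + length x′ / List⁺.length x

Square : List A → Set
Square {A} w = ∃[ x ] w ≡ toList {A = A} x ++ toList x

Overlap : List A → Set
Overlap w = ∃[ β ] β > + 2 / 1 × IsPower β w

_OccursIn_At_ : List A → InfiniteWord A → ℕ → Set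
u OccursIn w At i = applyUpTo (λ k → w (i ℕ.+ k)) (length u) ≡ u

Factor : List A → InfiniteWord A → Set
Factor u w = ∃[ i ] u OccursIn w At i

OverlapFree : InfiniteWord A → Set
OverlapFree w = ∀ u → Factor u w → ¬ Overlap u

{-# OPTIONS --safe #-}
-- Call k a repetition if w k ≡ w (1 + k).  Overlap-freeness forbids, after position 0,
-- repetitions at distance 1 or 3, and forces one among any four consecutive positions, so
-- consecutive repetitions lie at distance 2 or 4.  Neither distance can recur forever, since
-- this would create an overlap of period 4 or 8; hence some j has repetitions at j, 4 + j and
-- 6 + j and nowhere else in between.  No square begins at i = 2 + j.  Periods up to 3 are
-- excluded by inspection.  If the period is p ≥ 4, the repetition at 2 + i recurs at
-- 2 + i + p, so there is none at i + p - 1, three places earlier; hence the letter ending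
-- the first period differs from w i, as does w (i - 1).  On two letters these agree, and
-- the square extends to the left to an overlap.
module Submission where

open import Data.Empty using (⊥-elim)
open import Data.Fin.Base using (Fin; toℕ; fromℕ<)
open import Data.Fin.Patterns
open import Data.Fin.Properties using (_≟_; toℕ-fromℕ<)
open import Data.Integer.Base using (+_)
open import Data.List.Base using (List; []; _∷_; _∷ʳ_; _++_; applyUpTo; length)
open import Data.List.NonEmpty as List⁺ using (toList)
open import Data.List.Properties using (++-assoc; ++-identityʳ; applyUpTo-∷ʳ; length-applyUpTo; ∷-injectiveˡ; ∷-injectiveʳ)
open import Data.List.Relation.Binary.Prefix.Heterogeneous using ([]; _∷_)
open import Data.Nat.Base using (ℕ; zero; suc; _+_; _≤_; _<_; z≤n; s≤s⁻¹; s<s⁻¹; z<s; s<s)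
open import Data.Nat.Properties using (+-assoc; +-comm; +-suc; <⇒≤)
open import Data.Product.Base using (∃-syntax; _×_; _,_; proj₁; proj₂)
open import Data.Rational.Base as ℚ using (_/_; _>_)
import Data.Rational.Properties as ℚ
open import Data.Sum.Base using (_⊎_; inj₁; inj₂)
open import Function.Base using (_∘_)
open import Relation.Binary.PropositionalEquality
open import Relation.Nullary.Decidable.Core using (yes; no)
open import Relation.Nullary.Negation.Core using (¬_)
open import Defs

applyUpTo-cong : ∀ {A : Set} {f g : ℕ → A} n → (∀ k → k < n → f k ≡ g k) → applyUpTo f n ≡ applyUpTo g n
applyUpTo-cong zero    f≗g = refl
applyUpTo-cong (suc n) f≗g = cong₂ _∷_ (f≗g 0 z<s) (applyUpTo-cong n λ k k<n → f≗g (suc k) (s<s k<n))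

applyUpTo-injective : ∀ {A : Set} (f g : ℕ → A) n → applyUpTo f n ≡ applyUpTo g n → ∀ k → k < n → f k ≡ g k
applyUpTo-injective f g (suc n) eq zero    _   = ∷-injectiveˡ eq
applyUpTo-injective f g (suc n) eq (suc k) k<n = applyUpTo-injective (f ∘ suc) (g ∘ suc) n (∷-injectiveʳ eq) k (s<s⁻¹ k<n)

applyUpTo-+ : ∀ {A : Set} (f : ℕ → A) m n → applyUpTo f (m + n) ≡ applyUpTo f m ++ applyUpTo (λ k → f (m + k)) n
applyUpTo-+ f zero    n = refl
applyUpTo-+ f (suc m) n = cong (f 0 ∷_) (applyUpTo-+ (f ∘ suc) m n)

applyUpTo-++⁻ : ∀ {A : Set} (f : ℕ → A) xs ys → applyUpTo f (length (xs ++ ys)) ≡ xs ++ ys →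
  applyUpTo f (length xs) ≡ xs × applyUpTo (λ k → f (length xs + k)) (length ys) ≡ ys
applyUpTo-++⁻ f []       ys eq = refl , eq
applyUpTo-++⁻ f (x ∷ xs) ys eq with applyUpTo-++⁻ (f ∘ suc) xs ys (∷-injectiveʳ eq)
... | eq₁ , eq₂ = cong₂ _∷_ (∷-injectiveˡ eq) eq₁ , eq₂

i+[p+k]≡k+[p+i] : ∀ i p k → i + (p + k) ≡ k + (p + i)
i+[p+k]≡k+[p+i] i p k = trans (+-comm i (p + k)) (trans (cong (_+ i) (+-comm p k)) (+-assoc k p i))

-- The offset `k` stands left of `+` so that numeral offsets compute in the later case analyses. The
-- period is `suc p` because `x` is nonempty.
square⇒period : ∀ {A : Set} (w : InfiniteWord A) i → ∃[ xx ] Square xx × xx OccursIn w At i →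
  ∃[ p ] (∀ k → k < suc p → w (k + i) ≡ w (k + (suc p + i)))
square⇒period w i (_ , (x , refl) , occ) = length (List⁺.tail x) , λ k k<p →
  trans (cong w (+-comm k i))
    (trans (applyUpTo-injective f (λ m → f (p + m)) p (trans (proj₁ halves) (sym (proj₂ halves))) k k<p)
      (cong w (i+[p+k]≡k+[p+i] i p k)))
  where
  p = length (toList x)
  f : ℕ → _
  f k = w (i + k)
  halves = applyUpTo-++⁻ f (toList x) (toList x) occ

-- The bound `k ≤ suc p` gives one agreement more than a square has. With `n = suc p`, the factor of
-- length `2n + 1` at `i` is then `xxa`, where `a` is the first letter of `x`: a power of exponent
-- `2 + 1/n`.
overlapFree⇒aperiodic : ∀ {A : Set} (w : InfiniteWord A) → OverlapFree w →
  ∀ i p → ¬ (∀ k → k ≤ suc p → w (k + i) ≡ w (k + (suc p + i)))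
overlapFree⇒aperiodic w free i p periodic =
  free u (i , cong (applyUpTo f) (length-applyUpTo f (n + suc n)))
    (+ 2 / 1 ℚ.+ + 1 / n , 2<β , 2 , f 0 List⁺.∷ applyUpTo (f ∘ suc) p , f 0 ∷ [] , refl ∷ [] , u≡xxa ,
     cong (λ m → + 2 / 1 ℚ.+ + 1 / suc m) (sym (length-applyUpTo (f ∘ suc) p)))
  where
  n = suc p
  f : ℕ → _
  f k = w (i + k)
  u x : List _
  u = applyUpTo f (n + suc n)
  x = applyUpTo f n

  2<β : + 2 / 1 ℚ.+ + 1 / n > + 2 / 1
  2<β = subst (ℚ._< (+ 2 / 1 ℚ.+ + 1 / n)) (ℚ.+-identityʳ (+ 2 / 1))
    (ℚ.+-monoʳ-< (+ 2 / 1) (ℚ.positive⁻¹ (+ 1 / n) {{ℚ.normalize-pos 1 n}}))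

  shift : ∀ k → k ≤ n → f (n + k) ≡ f k
  shift k k≤n = trans (cong w (i+[p+k]≡k+[p+i] i n k)) (trans (sym (periodic k k≤n)) (cong w (+-comm k i)))

  fn≡f0 : f n ≡ f 0
  fn≡f0 = trans (cong f (+-comm 0 n)) (shift 0 z≤n)

  open ≡-Reasoning
  -- The inner `[]` and the bracketing are what `concat (replicate 2 x)` unfolds to.
  u≡xxa : u ≡ (x ++ (x ++ [])) ++ f 0 ∷ []
  u≡xxa = begin
    u                                             ≡⟨ applyUpTo-+ f n (suc n) ⟩
    x ++ applyUpTo (λ k → f (n + k)) (suc n)      ≡⟨ cong (x ++_) (applyUpTo-cong (suc n) λ k k<1+n → shift k (s≤s⁻¹ k<1+n)) ⟩
    x ++ applyUpTo f (suc n)                      ≡⟨ cong (x ++_) (applyUpTo-∷ʳ f n) ⟨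
    x ++ (x ∷ʳ f n)                               ≡⟨ cong (λ a → x ++ (x ∷ʳ a)) fn≡f0 ⟩
    x ++ (x ∷ʳ f 0)                               ≡⟨ cong (λ y → x ++ (y ∷ʳ f 0)) (++-identityʳ x) ⟨
    x ++ ((x ++ []) ∷ʳ f 0)                       ≡⟨ ++-assoc x (x ++ []) (f 0 ∷ []) ⟨
    (x ++ (x ++ [])) ++ f 0 ∷ []                  ∎

-- The one place where having just two letters matters.
≢-≢⇒≡ : ∀ {x y z : Fin 2} → x ≢ y → y ≢ z → x ≡ z
≢-≢⇒≡ {0F} {0F} {_}  x≢y y≢z = ⊥-elim (x≢y refl)
≢-≢⇒≡ {0F} {1F} {0F} x≢y y≢z = refl
≢-≢⇒≡ {0F} {1F} {1F} x≢y y≢z = ⊥-elim (y≢z refl)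
≢-≢⇒≡ {1F} {0F} {0F} x≢y y≢z = ⊥-elim (y≢z refl)
≢-≢⇒≡ {1F} {0F} {1F} x≢y y≢z = refl
≢-≢⇒≡ {1F} {1F} {_}  x≢y y≢z = ⊥-elim (x≢y refl)

module Repetitions (w : InfiniteWord (Fin 2)) (free : OverlapFree w) where

  Rep : ℕ → Set
  Rep k = w k ≡ w (suc k)

  SameRep : ℕ → ℕ → Set
  SameRep j k = (Rep j × Rep k) ⊎ (¬ Rep j × ¬ Rep k)

  agree-suc : ∀ {j k} → w j ≡ w k → SameRep j k → w (suc j) ≡ w (suc k)
  agree-suc eq (inj₁ (dj , dk)) = trans (sym dj) (trans eq dk)
  agree-suc eq (inj₂ (nj , nk)) = ≢-≢⇒≡ (nj ∘ sym) (nk ∘ trans (sym eq))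

  -- One letter and the pattern of repetitions determine a binary word. Equal patterns alone would
  -- also allow the second stretch to be the complement of the first; the hypothesis on `w i`
  -- excludes this.
  reps-aperiodic : ∀ i p → w i ≡ w (suc p + i) →
    ¬ (∀ (k : Fin (suc p)) → SameRep (toℕ k + i) (toℕ k + (suc p + i)))
  reps-aperiodic i p start same = overlapFree⇒aperiodic w free i p agree
    where
    agree : ∀ k → k ≤ suc p → w (k + i) ≡ w (k + (suc p + i))
    agree zero    _   = start
    agree (suc k) k<n = agree-suc (agree k (<⇒≤ k<n))
      (subst (λ m → SameRep (m + i) (m + (suc p + i))) (toℕ-fromℕ< k<n) (same (fromℕ< k<n)))

  -- The word `aaa` is an overlap of period 1.
  rep⇒¬rep[1+] : ∀ {j} → Rep j → ¬ Rep (1 + j)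
  rep⇒¬rep[1+] {j} d₀ d₁ = reps-aperiodic j 0 d₀ λ { 0F → inj₁ (d₀ , d₁) }

  rep[1+]⇒¬rep : ∀ {j} → Rep (1 + j) → ¬ Rep j
  rep[1+]⇒¬rep d₁ d₀ = rep⇒¬rep[1+] d₀ d₁

  -- aabaa can only be a prefix: anywhere else it extends to b aabaa b, of period 3.
  rep⇒¬rep[3+] : ∀ {j} → Rep (suc j) → ¬ Rep (3 + suc j)
  rep⇒¬rep[3+] {j} d₁ d₄ = reps-aperiodic j 2 start λ where
      0F → inj₂ (n₀ , n₃)
      1F → inj₁ (d₁ , d₄)
      2F → inj₂ (n₂ , n₅)
    where
    n₀ = rep[1+]⇒¬rep d₁
    n₂ = rep⇒¬rep[1+] d₁
    n₃ = rep[1+]⇒¬rep d₄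
    n₅ = rep⇒¬rep[1+] d₄
    start : w j ≡ w (3 + j)
    start = ≢-≢⇒≡ n₀ (n₂ ∘ trans (sym d₁))

  -- Otherwise the five letters from `j` on are `ababa`, an overlap of period 2.
  rep-within-4 : ∀ {j} → ¬ Rep j → ¬ Rep (1 + j) → ¬ Rep (2 + j) → Rep (3 + j)
  rep-within-4 {j} n₀ n₁ n₂ with w (3 + j) ≟ w (4 + j)
  ... | yes d₃ = d₃
  ... | no  n₃ = ⊥-elim (reps-aperiodic j 1 (≢-≢⇒≡ n₀ n₁) λ where
    0F → inj₂ (n₀ , n₂)
    1F → inj₂ (n₁ , n₃))

  -- The search starts at 1 because `rep⇒¬rep[3+]` needs a letter before the repetition.
  first-rep : ∃[ j ] Rep (suc j)
  first-rep with w 1 ≟ w 2 | w 2 ≟ w 3 | w 3 ≟ w 4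
  ... | yes d₁ | _      | _      = 0 , d₁
  ... | no  _  | yes d₂ | _      = 1 , d₂
  ... | no  _  | no  _  | yes d₃ = 2 , d₃
  ... | no  n₁ | no  n₂ | no  n₃ = 3 , rep-within-4 n₁ n₂ n₃

  ShortGap LongGap : ℕ → Set
  ShortGap j = Rep j × ¬ Rep (1 + j) × Rep (2 + j)
  LongGap  j = Rep j × ¬ Rep (1 + j) × ¬ Rep (2 + j) × ¬ Rep (3 + j) × Rep (4 + j)

  gap : ∀ {j} → Rep (suc j) → ShortGap (suc j) ⊎ LongGap (suc j)
  gap {j} d₀ with w (2 + suc j) ≟ w (3 + suc j)
  ... | yes d₂ = inj₁ (d₀ , rep⇒¬rep[1+] d₀ , d₂)
  ... | no  n₂ = inj₂ (d₀ , n₁ , n₂ , n₃ , rep-within-4 n₁ n₂ n₃)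
    where
    n₁ = rep⇒¬rep[1+] d₀
    n₃ = rep⇒¬rep[3+] d₀

  -- A short gap changes the letter once, so the pattern has period 2 but the word has period 4: it
  -- reads `aabbaabba`.
  ¬3-short-gaps : ∀ {j} → ShortGap (suc j) → ShortGap (2 + suc j) → ¬ ShortGap (4 + suc j)
  ¬3-short-gaps {j} (d₀ , n₁ , d₂) (_ , n₃ , d₄) (_ , n₅ , d₆) =
    reps-aperiodic (suc j) 3 start λ where
      0F → inj₁ (d₀ , d₄)
      1F → inj₂ (n₁ , n₅)
      2F → inj₁ (d₂ , d₆)
      3F → inj₂ (n₃ , rep⇒¬rep[1+] d₆)
    where
    start : w (suc j) ≡ w (4 + suc j)
    start = ≢-≢⇒≡ (n₁ ∘ trans (sym d₀)) (n₃ ∘ trans (sym d₂))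

  -- A long gap changes the letter three times, an odd number, so the word recurs only after two
  -- gaps: it reads `aababbab` twice and then `a`.
  ¬4-long-gaps : ∀ {j} → LongGap j → LongGap (4 + j) → LongGap (8 + j) → ¬ LongGap (12 + j)
  ¬4-long-gaps {j} (d₀ , n₁ , n₂ , n₃ , d₄) (_ , n₅ , n₆ , n₇ , d₈)
    (_ , n₉ , n₁₀ , n₁₁ , d₁₂) (_ , n₁₃ , n₁₄ , n₁₅ , _) =
    reps-aperiodic j 7 start λ where
      0F → inj₁ (d₀ , d₈)
      1F → inj₂ (n₁ , n₉)
      2F → inj₂ (n₂ , n₁₀)
      3F → inj₂ (n₃ , n₁₁)
      4F → inj₁ (d₄ , d₁₂)
      5F → inj₂ (n₅ , n₁₃)
      6F → inj₂ (n₆ , n₁₄)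
      7F → inj₂ (n₇ , n₁₅)
    where
    w₀≡w₃ : w j ≡ w (3 + j)
    w₀≡w₃ = trans d₀ (≢-≢⇒≡ n₁ n₂)
    w₃≡w₆ : w (3 + j) ≡ w (6 + j)
    w₃≡w₆ = ≢-≢⇒≡ n₃ (n₅ ∘ trans (sym d₄))
    start : w j ≡ w (8 + j)
    start = trans w₀≡w₃ (trans w₃≡w₆ (≢-≢⇒≡ n₆ n₇))

  long-gap : ∃[ j ] LongGap (suc j)
  long-gap with first-rep
  ... | j , d₀ with gap d₀
  ... | inj₂ l₀ = _ , l₀
  ... | inj₁ s₀@(_ , _ , d₂) with gap d₂
  ... | inj₂ l₂ = _ , l₂
  ... | inj₁ s₂@(_ , _ , d₄) with gap d₄
  ... | inj₂ l₄ = _ , l₄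
  ... | inj₁ s₄ = ⊥-elim (¬3-short-gaps s₀ s₂ s₄)

  long-then-short : ∃[ j ] LongGap (suc j) × ShortGap (4 + suc j)
  long-then-short with long-gap
  ... | j , l₀@(_ , _ , _ , _ , d₄) with gap d₄
  ... | inj₁ s = _ , l₀ , s
  ... | inj₂ l₄@(_ , _ , _ , _ , d₈) with gap d₈
  ... | inj₁ s = _ , l₄ , s
  ... | inj₂ l₈@(_ , _ , _ , _ , d₁₂) with gap d₁₂
  ... | inj₁ s = _ , l₈ , s
  ... | inj₂ l₁₂ = ⊥-elim (¬4-long-gaps l₀ l₄ l₈ l₁₂)

  -- From `2 + j` on the word reads `abaabb`, which rules out periods 1, 2 and 3. The number `p` is
  -- one less than the period.
  no-period-at-2+ : ∀ {j} → LongGap j → ShortGap (4 + j) →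
    ∀ p → ¬ (∀ k → k < suc p → w (k + (2 + j)) ≡ w (k + (suc p + (2 + j))))
  no-period-at-2+ (_ , _ , n₂ , _ , _) _ 0 periodic = n₂ (periodic 0 z<s)
  no-period-at-2+ (_ , _ , _ , n₃ , d₄) _ 1 periodic = n₃ (trans (periodic 1 (s<s z<s)) (sym d₄))
  no-period-at-2+ (_ , _ , _ , _ , d₄) (_ , n₅ , d₆) 2 periodic =
    n₅ (trans (sym d₄) (trans (periodic 2 (s<s (s<s z<s))) (sym d₆)))
  no-period-at-2+ {j} (_ , n₁ , _ , _ , d₄) _ (suc (suc (suc q))) periodic =
    overlapFree⇒aperiodic w free (1 + j) (3 + q) extended
    where
    -- Offsets 2 and 3 both lie within the first period, whose length is `4 + q`, so the repetition
    -- at `4 + j` is copied one period later.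
    recurs : Rep (6 + (q + (2 + j)))
    recurs = trans (sym (periodic 2 (s<s (s<s z<s)))) (trans d₄ (periodic 3 (s<s (s<s (s<s z<s)))))

    ends-differ : ¬ Rep (3 + (q + (2 + j)))
    ends-differ d = rep⇒¬rep[3+] d recurs

    same-predecessor : w (1 + j) ≡ w (3 + (q + (2 + j)))
    same-predecessor = ≢-≢⇒≡ n₁ λ e → ends-differ (trans (sym e) (periodic 0 z<s))

    extended : ∀ k → k ≤ 4 + q → w (k + (1 + j)) ≡ w (k + (4 + q + (1 + j)))
    -- This is the letter gained on the left; the other `4 + q` agreements are those of the square,
    -- with offsets now counted from `1 + j`.
    extended zero    _   = trans same-predecessor (cong w (+-suc (3 + q) (1 + j)))
    extended (suc k) k<p = begin
      w (suc k + (1 + j))             ≡⟨ cong w (+-suc k (1 + j)) ⟨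
      w (k + (2 + j))                 ≡⟨ periodic k k<p ⟩
      w (k + (4 + q + (2 + j)))       ≡⟨ cong (λ m → w (k + m)) (+-suc (4 + q) (1 + j)) ⟩
      w (k + suc (4 + q + (1 + j)))   ≡⟨ cong w (+-suc k (4 + q + (1 + j))) ⟩
      w (suc k + (4 + q + (1 + j)))   ∎
      where open ≡-Reasoning

theorem1 : (w : InfiniteWord (Fin 2)) → OverlapFree w →
    ∃[ i ] ¬ (∃[ xx ] Square xx × xx OccursIn w At i)
theorem1 w free with Repetitions.long-then-short w free
-- The long gap starts at `suc j`, so the position two places later is `3 + j`.
... | j , long , short = 3 + j , λ square →
  let p , periodic = square⇒period w (3 + j) square
  in Repetitions.no-period-at-2+ w free long short p periodic
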